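{- Let $G$ be a graph. Then $\operatorname{mw}(G)=\omega(G)$, where $\operatorname{mw}(G)$ is the median-width of $G$ and $\omega(G)$ is its clique number.
   Context: Graphs are simple and undirected, and may be finite or infinite. A clique is a set of pairwise adjacent vertices, and the clique number $\omega(G)$ is the size of the largest clique of $G$ (the supremum of the sizes of cliques of $G$). For vertices $u,v$ of a connected graph, $d(u,v)$ is the length of a shortest path (geodesic) from $u$ to $v$, and the interval $I(u,v)$ is the set of vertices $x$ with $d(u,v)=d(u,x)+d(x,v)$, i.e. the vertices lying on some geodesic from $u$ to $v$. A median graph is a connected graph (finite or infinite) in which $I(u,v)\cap I(v,w)\cap I(w,u)$ contains exactly one vertex for every three distinct vertices $u,v,w$. A subgraph $C$ of a graph is convex if every geodesic of the graph with endpoints in $C$ is contained in $C$. A median decomposition of $G$ is a pair $(M,\beta)$, where $M$ is a median graph and $\beta:V(M)\to\mathcal P(V(G))$ is a map such that (M1) $\bigcup_{u\in V(M)}\beta(u)=V(G)$; (M2) for every edge $xy$ of $G$ there exists $u\in V(M)$ with $\{x,y\}\subseteq\beta(u)$; (M3) for every $v\in V(G)$ the set $\beta^{ -1}(v)=\{u\in V(M): v\in\beta(u)\}$ induces a convex subgraph of $M$. The width of $(M,\beta)$ is $\sup_{u\in V(M)}|\beta(u)|$. The median-width $\operatorname{mw}(G)$ is the infimum of the widths of all median decompositions of $G$ (with no "$-1$"). -}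

module Defs where

open import Level using (Level; _⊔_; Lift; lift; lower) renaming (suc to lsuc)
open import Axiom.ExcludedMiddle using (ExcludedMiddle)
open import Data.Fin.Base using (Fin; zero; suc; inject₁; fromℕ)
open import Data.Nat.Base using (ℕ; zero; suc; _+_; _≤_; _<_)
open import Data.Nat.Induction using (<-rec)
open import Data.Nat.Properties using (≮⇒≥)
open import Data.Product using (Σ-syntax; ∃; ∃-syntax; ∃!; _×_; _,_; proj₁; proj₂)
open import Function.Bundles using (Bijection)
open import Function.Definitions using (Injective)
open import Relation.Binary.Bundles using (Setoid)
open import Relation.Binary.Core using (Rel)
open import Relation.Binary.Definitions
  using (Symmetric; Irreflexive; _Respects_; _Respects₂_)
import Relation.Binary.Construct.On as On
open import Relation.Binary.Construct.Add.Supremum.NonStrict _≤_ public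
  using (_≤⁺_; [_]; _≤⊤⁺)
open import Relation.Binary.PropositionalEquality.Core using (_≡_; subst)
import Relation.Binary.PropositionalEquality.Properties as ≡
open import Relation.Nullary using (¬_; yes; no; contradiction)
open import Relation.Nullary.Construct.Add.Supremum public using (_⁺; ⊤⁺; [_])
open import Relation.Nullary.Decidable using (map′)
open import Relation.Unary using (Pred; _∩_; _∈_)

private
  variable
    a ℓ : Level

-- Extended naturals.  Infinite cardinalities are not distinguished from one
-- another: they are all ⊤⁺.

ℕ∞ : Set
ℕ∞ = ℕ ⁺

IsSupremum : {I : Set a} → (I → ℕ∞) → ℕ∞ → Set a
IsSupremum f s = (∀ i → f i ≤⁺ s) × (∀ b → (∀ i → f i ≤⁺ b) → s ≤⁺ b)

IsInfimum : {I : Set a} → (I → ℕ∞) → ℕ∞ → Set a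
IsInfimum f s = (∀ i → s ≤⁺ f i) × (∀ b → (∀ i → b ≤⁺ f i) → b ≤⁺ s)

-- Existence of suprema and infima in ℕ∞ is not constructive, so it is derived
-- from excluded middle, passed as an argument.

private
  least : ExcludedMiddle a → (P : Pred ℕ a) → ∃ P →
          ∃[ n ] P n × (∀ k → P k → n ≤ k)
  least em P (m , pm) = <-rec (λ n → P n → _) step m pm
    where
    step : ∀ n → (∀ {k} → k < n → P k → ∃[ n ] P n × (∀ k → P k → n ≤ k)) →
           P n → ∃[ n ] P n × (∀ k → P k → n ≤ k)
    step n rec pn with em {∃[ k ] k < n × P k}
    ... | yes (k , k<n , pk) = rec k<n pk
    ... | no ¬smaller        = n , pn , λ k pk → ≮⇒≥ λ k<n → ¬smaller (k , k<n , pk)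

infimum : ExcludedMiddle a → {I : Set a} (f : I → ℕ∞) → ∃ (IsInfimum f)
infimum em f with em {∃[ n ] ∃[ i ] f i ≡ [ n ]}
... | no ¬finite = ⊤⁺ , lowerBound , λ b _ → b ≤⊤⁺
  where
  lowerBound : ∀ i → ⊤⁺ ≤⁺ f i
  lowerBound i with f i in eq
  ... | [ n ] = contradiction (n , i , eq) ¬finite
  ... | ⊤⁺    = ⊤⁺ ≤⊤⁺
... | yes finite with least em (λ n → ∃[ i ] f i ≡ [ n ]) finite
...   | n , (j , fj≡n) , minimal =
  [ n ] , lowerBound , λ b b≤f → subst (b ≤⁺_) fj≡n (b≤f j)
  where
  lowerBound : ∀ i → [ n ] ≤⁺ f i
  lowerBound i with f i in eq
  ... | [ k ] = [ minimal k (i , eq) ]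
  ... | ⊤⁺    = [ n ] ≤⊤⁺

supremum : ExcludedMiddle a → {I : Set a} (f : I → ℕ∞) → ∃ (IsSupremum f)
supremum em {I} f with infimum em {Σ[ b ∈ ℕ∞ ] (∀ i → f i ≤⁺ b)} proj₁
... | s , isLower , isGreatest =
  s , (λ i → isGreatest (f i) λ (b , f≤b) → f≤b i) , λ b f≤b → isLower (b , f≤b)

⨆ : ExcludedMiddle a → {I : Set a} → (I → ℕ∞) → ℕ∞
⨆ em f = proj₁ (supremum em f)

⨅ : ExcludedMiddle a → {I : Set a} → (I → ℕ∞) → ℕ∞
⨅ em f = proj₁ (infimum em f)

lowerEM : ExcludedMiddle (lsuc ℓ) → ExcludedMiddle ℓ
lowerEM {ℓ} em = map′ lower lift (em {Lift (lsuc ℓ) _})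

module _ (S : Setoid ℓ ℓ) where
  open Setoid S

  HasSize : Pred Carrier ℓ → ℕ → Set ℓ
  HasSize A n = Bijection (≡.setoid (Fin n)) (On.setoid {B = ∃ A} S proj₁)

  card : ExcludedMiddle ℓ → Pred Carrier ℓ → ℕ∞
  card em A with em {∃ (HasSize A)}
  ... | yes (n , _) = [ n ]
  ... | no  _       = ⊤⁺

-- Vertices form a setoid because Agda has no quotients: graphs whose vertices
-- are, say, finite sets of vertices of another graph would otherwise be missing.

record Graph (ℓ : Level) : Set (lsuc ℓ) where
  field
    vertices   : Setoid ℓ ℓ
  open Setoid vertices public renaming (Carrier to V) using (_≈_)
  field
    Adj        : Rel V ℓ
    Adj-resp-≈ : Adj Respects₂ _≈_
    Adj-sym    : Symmetric Adj
    Adj-irrefl : Irreflexive _≈_ Adj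

module _ (G : Graph ℓ) where
  open Graph G

  record Path (u v : V) (n : ℕ) : Set ℓ where
    field
      vertex   : Fin (suc n) → V
      start    : vertex zero ≈ u
      end      : vertex (fromℕ n) ≈ v
      step     : ∀ (i : Fin n) → Adj (vertex (inject₁ i)) (vertex (suc i))
      distinct : Injective _≡_ _≈_ vertex

  Connected : Set ℓ
  Connected = ∀ u v → ∃ (Path u v)

  IsDistance : V → V → ℕ → Set ℓ
  IsDistance u v n = Path u v n × (∀ m → Path u v m → n ≤ m)

  I : V → V → Pred V ℓ
  I u v x = ∃[ m ] ∃[ n ]
    IsDistance u x m × IsDistance x v n × IsDistance u v (m + n)

  record IsMedianGraph : Set ℓ where
    field
      connected : Connected
      median    : ∀ u v w → ¬ u ≈ v → ¬ v ≈ w → ¬ w ≈ u →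
                  ∃! _≈_ (I u v ∩ I v w ∩ I w u)

  -- Convexity of the subgraph induced by C; being induced, it contains a
  -- geodesic as soon as it contains the vertices of the geodesic.
  IsConvex : Pred V ℓ → Set ℓ
  IsConvex C = ∀ {u v} → u ∈ C → v ∈ C → ∀ n → IsDistance u v n →
               (p : Path u v n) → ∀ i → Path.vertex p i ∈ C

  record Clique : Set (lsuc ℓ) where
    field
      members  : Pred V ℓ
      resp-≈   : members Respects _≈_
      adjacent : ∀ {x y} → x ∈ members → y ∈ members → ¬ x ≈ y → Adj x y

record MedianDecomposition (G : Graph ℓ) : Set (lsuc ℓ) where
  open Graph G
  field
    M        : Graph ℓ
    isMedian : IsMedianGraph M
  private module M = Graph M
  field
    β        : M.V → Pred V ℓ
    β-resp-M : ∀ {v} → (λ u → β u v) Respects M._≈_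
    β-resp-G : ∀ {u} → β u Respects _≈_
    M1       : ∀ v → ∃[ u ] v ∈ β u
    M2       : ∀ {x y} → Adj x y → ∃[ u ] (x ∈ β u × y ∈ β u)
    M3       : ∀ v → IsConvex M (λ u → v ∈ β u)

module _ (em : ExcludedMiddle (lsuc ℓ)) (G : Graph ℓ) where

  width : MedianDecomposition G → ℕ∞
  width D = ⨆ (lowerEM em) λ u → card (Graph.vertices G) (lowerEM em) (β u)
    where open MedianDecomposition D

  ω : ℕ∞
  ω = ⨆ em λ (K : Clique G) →
    card (Graph.vertices G) (lowerEM em) (Clique.members K)

  mw : ℕ∞
  mw = ⨅ em width

{-# OPTIONS --safe #-}
-- ω ≤ mw: for every v the bags containing v form a convex set, and these sets
-- meet pairwise when v ranges over a clique.  Convex sets of a median graph have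
-- the Helly property, the median of points of the three pairwise intersections
-- being common to three sets, so every finite clique lies in one bag.
--
-- mw ≤ ω: the simplex graph of G, whose vertices are the finite cliques K of G and
-- whose edges join cliques differing in one element, is a median graph; the bag at K
-- is K itself.  A walk of length n from A to B yields a list of n elements covering
-- the symmetric difference of A and B, and conversely; hence X lies between A and B
-- iff A ∩ B ⊆ X ⊆ A ∪ B, and the median of three cliques is their majority.
module Submission where

open import Defs
open import Level using (Level; suc)
open import Axiom.ExcludedMiddle using (ExcludedMiddle)
open import Data.Fin.Base as Fin using (Fin; zero; inject₁; fromℕ; toℕ)
open import Data.Fin.Properties using (toℕ≤pred[n]; injective⇒≤)
open import Data.List.Base using (List; []; _∷_; _++_; filter; length)
open import Data.List.Properties using (filter-notAll; length-++)
import Data.List.Membership.Setoid as Membership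
import Data.List.Membership.Setoid.Properties as Membershipₚ
open import Data.List.Relation.Unary.Any as Any using (here; there)
open import Data.Nat.Base as ℕ using (ℕ; zero; _+_; _∸_; _≤_; _<_; z≤n; s≤s)
open import Data.Nat.Induction using (<-rec)
open import Data.Nat.Properties
  using (≤-antisym; ≤-refl; ≤-trans; ≤-pred; <⇒≱; ≮⇒≥; <⇒≤; +-mono-≤; +-suc;
         m∸n≤m; m+[n∸m]≡n; 1+n≰n; m≤n⇒m≤1+n)
open import Data.Product using (∃; _×_; _,_; proj₁; proj₂; map₂)
open import Data.Sum.Base using (_⊎_; inj₁; inj₂; [_,_]′)
open import Function.Base using (_∘_; id)
open import Function.Bundles using (Bijection)
open import Function.Definitions using (Injective)
open import Relation.Binary.Bundles using (Setoid)
open import Relation.Binary.Construct.Add.Supremum.NonStrict _≤_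
  using (≤⁺-antisym-≡; ≤⁺-trans)
open import Relation.Binary.PropositionalEquality using (_≡_; refl; sym; cong; subst)
open import Relation.Nullary using (¬_; Dec; yes; no; contradiction)
open import Relation.Unary using (Pred; _∈_; _∩_)
open import Relation.Binary.Definitions using (_Respects_)

private
  variable
    ℓ : Level

-- Walks, geodesics and convex sets.

module Walks (em : ExcludedMiddle ℓ) (G : Graph ℓ) where
  open Graph G
  open Setoid vertices using () renaming (refl to ≈-refl; sym to ≈-sym; trans to ≈-trans)

  -- Walks may repeat vertices, so they can be concatenated freely, unlike `Path`. `nil` carries an
  -- equivalence rather than an identity so that endpoints can be moved within their `_≈_` class.
  data Walk : V → V → ℕ → Set ℓ where
    nil  : ∀ {u v} → u ≈ v → Walk u v 0
    cons : ∀ {u w v n} → Adj u w → Walk w v n → Walk u v (ℕ.suc n)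

  Shortest : V → V → ℕ → Set ℓ
  Shortest u v n = ∀ m → Walk u v m → n ≤ m

  adj-respˡ : ∀ {u u′ v} → u ≈ u′ → Adj u v → Adj u′ v
  adj-respˡ = proj₂ Adj-resp-≈

  walk-respˡ : ∀ {u u′ v n} → u ≈ u′ → Walk u v n → Walk u′ v n
  walk-respˡ u≈u′ (nil u≈v)  = nil (≈-trans (≈-sym u≈u′) u≈v)
  walk-respˡ u≈u′ (cons a p) = cons (adj-respˡ u≈u′ a) p

  walk-respʳ : ∀ {u v v′ n} → v ≈ v′ → Walk u v n → Walk u v′ n
  walk-respʳ v≈v′ (nil u≈v)  = nil (≈-trans u≈v v≈v′)
  walk-respʳ v≈v′ (cons a p) = cons a (walk-respʳ v≈v′ p)

  snoc : ∀ {u v w n} → Walk u v n → Adj v w → Walk u w (ℕ.suc n)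
  snoc (nil u≈v)  b = cons (adj-respˡ (≈-sym u≈v) b) (nil ≈-refl)
  snoc (cons a p) b = cons a (snoc p b)

  concat : ∀ {u v w m n} → Walk u v m → Walk v w n → Walk u w (m + n)
  concat (nil u≈v)  q = walk-respˡ (≈-sym u≈v) q
  concat (cons a p) q = cons a (concat p q)

  vertexAt : ∀ {u v n} → Walk u v n → Fin (ℕ.suc n) → V
  vertexAt {u} p          zero        = u
  vertexAt     (cons a p) (Fin.suc i) = vertexAt p i

  vertexAt-end : ∀ {u v n} (p : Walk u v n) → vertexAt p (fromℕ n) ≈ v
  vertexAt-end (nil u≈v)  = u≈v
  vertexAt-end (cons a p) = vertexAt-end p

  vertexAt-step : ∀ {u v n} (p : Walk u v n) (i : Fin n) →
                  Adj (vertexAt p (inject₁ i)) (vertexAt p (Fin.suc i))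
  vertexAt-step (cons a p) zero        = a
  vertexAt-step (cons a p) (Fin.suc i) = vertexAt-step p i

  vertexAt-concat : ∀ {u v w m n} (p : Walk u v m) (q : Walk v w n) →
                    ∃ λ i → vertexAt (concat p q) i ≈ v
  vertexAt-concat (nil u≈v)  q = zero , u≈v
  vertexAt-concat (cons a p) q with vertexAt-concat p q
  ... | i , eq = Fin.suc i , eq

  drop : ∀ {u v n} (p : Walk u v n) (i : Fin (ℕ.suc n)) →
         Walk (vertexAt p i) v (n ∸ toℕ i)
  drop p          zero        = p
  drop (cons a p) (Fin.suc i) = drop p i

  -- A repetition closes a cycle, and cutting it out leaves a shorter walk. It is enough to treat a
  -- return to the first vertex, since a tail of a shortest walk is again shortest.
  shortest-distinct : ∀ {u v n} (p : Walk u v n) → Shortest u v n →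
                      Injective _≡_ _≈_ (vertexAt p)
  shortest-distinct p s {zero} {zero} eq = refl
  shortest-distinct {n = ℕ.suc n} (cons a p) s {zero} {Fin.suc j} eq =
    contradiction (≤-trans (s _ (walk-respˡ (≈-sym eq) (drop p j))) (m∸n≤m n (toℕ j))) 1+n≰n
  shortest-distinct {n = ℕ.suc n} (cons a p) s {Fin.suc i} {zero} eq =
    contradiction (≤-trans (s _ (walk-respˡ eq (drop p i))) (m∸n≤m n (toℕ i))) 1+n≰n
  shortest-distinct (cons a p) s {Fin.suc i} {Fin.suc j} eq =
    cong Fin.suc (shortest-distinct p (λ m q → ≤-pred (s _ (cons a q))) eq)

  shortest-path : ∀ {u v n} → Walk u v n → Shortest u v n → Path G u v n
  shortest-path p s = record
    { vertex   = vertexAt p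
    ; start    = ≈-refl
    ; end      = vertexAt-end p
    ; step     = vertexAt-step p
    ; distinct = shortest-distinct p s
    }

  prefix : ∀ {n} (f : Fin (ℕ.suc n) → V) → (∀ i → Adj (f (inject₁ i)) (f (Fin.suc i))) →
           ∀ i → Walk (f zero) (f i) (toℕ i)
  prefix             f a zero        = nil ≈-refl
  prefix {ℕ.suc n} f a (Fin.suc i) =
    cons (a zero) (prefix (f ∘ Fin.suc) (a ∘ Fin.suc) i)

  suffix : ∀ {n} (f : Fin (ℕ.suc n) → V) → (∀ i → Adj (f (inject₁ i)) (f (Fin.suc i))) →
           ∀ i → Walk (f i) (f (fromℕ n)) (n ∸ toℕ i)
  suffix {zero}    f a zero        = nil ≈-refl
  suffix {ℕ.suc n} f a zero        = cons (a zero) (suffix (f ∘ Fin.suc) (a ∘ Fin.suc) zero)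
  suffix {ℕ.suc n} f a (Fin.suc i) = suffix (f ∘ Fin.suc) (a ∘ Fin.suc) i

  path-prefix : ∀ {u v n} (p : Path G u v n) i → Walk u (Path.vertex p i) (toℕ i)
  path-prefix p i = walk-respˡ (Path.start p) (prefix (Path.vertex p) (Path.step p) i)

  path-suffix : ∀ {u v n} (p : Path G u v n) i → Walk (Path.vertex p i) v (n ∸ toℕ i)
  path-suffix p i = walk-respʳ (Path.end p) (suffix (Path.vertex p) (Path.step p) i)

  path-walk : ∀ {u v n} → Path G u v n → Walk u v n
  path-walk p = walk-respˡ (Path.start p) (path-suffix p zero)

  shortest-distance : ∀ {u v n} → Walk u v n → Shortest u v n → IsDistance G u v n
  shortest-distance p s = shortest-path p s , λ m q → s m (path-walk q)

  -- Descent on the length: as long as a shorter walk exists, pass to it. A walk that cannot be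
  -- shortened is a path, by `shortest-distinct`.
  walk-distance : ∀ {u v n} → Walk u v n → ∃ λ m → m ≤ n × IsDistance G u v m
  walk-distance {u} {v} {n} =
    <-rec (λ n → Walk u v n → ∃ λ m → m ≤ n × IsDistance G u v m) shorten n
    where
    shorten : ∀ n → (∀ {k} → k < n → Walk u v k → ∃ λ m → m ≤ k × IsDistance G u v m) →
              Walk u v n → ∃ λ m → m ≤ n × IsDistance G u v m
    shorten n rec p with em {∃ λ k → k < n × Walk u v k}
    ... | no ¬shorter =
      n , ≤-refl , shortest-distance p λ m q → ≮⇒≥ λ m<n → ¬shorter (m , m<n , q)
    ... | yes (k , k<n , q) with rec k<n q
    ...   | m , m≤k , d = m , ≤-trans m≤k (<⇒≤ k<n) , d

  -- `IsDistance` compares with paths only. Every walk has a path of no greater length between its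
  -- ends, so the same bound holds against walks.
  distance-shortest : ∀ {u v n} → IsDistance G u v n → Shortest u v n
  distance-shortest (_ , minimal) m q with walk-distance q
  ... | k , k≤m , (p , _) = ≤-trans (minimal k p) k≤m

  -- Geodesics from `u` to `x` and from `x` to `v` join to a walk through `x` whose length is the
  -- distance of `u` and `v`. It is therefore a geodesic, and convexity applies to it.
  convex-interval : ∀ {C : Pred V ℓ} → C Respects _≈_ → IsConvex G C →
                    ∀ {u v x} → u ∈ C → v ∈ C → x ∈ I G u v → x ∈ C
  convex-interval {C} resp convex u∈C v∈C (m , n , (p , _) , (q , _) , d) =
    let i , eq = vertexAt-concat (path-walk p) (path-walk q)
    in resp eq (convex u∈C v∈C (m + n) d
         (shortest-path (concat (path-walk p) (path-walk q)) (distance-shortest d)) i)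

  IsConvex-∩ : ∀ {C D : Pred V ℓ} → IsConvex G C → IsConvex G D → IsConvex G (C ∩ D)
  IsConvex-∩ c d (u∈C , u∈D) (v∈C , v∈D) n δ p i = c u∈C v∈C n δ p i , d u∈D v∈D n δ p i

  -- The Helly property of convex sets in a median graph.

  module _ (isMedian : IsMedianGraph G) where
    open IsMedianGraph isMedian

    -- Each set contains two of the points `a`, `b`, `c`, hence the interval between them, and the
    -- median lies in all three intervals. Medians are only given for distinct vertices; if two of
    -- the points coincide, that point already lies in all three sets.
    helly₃ : ∀ {A B C : Pred V ℓ} →
             A Respects _≈_ → B Respects _≈_ → C Respects _≈_ →
             IsConvex G A → IsConvex G B → IsConvex G C →
             ∃ (B ∩ C) → ∃ (C ∩ A) → ∃ (A ∩ B) → ∃ λ x → x ∈ A × x ∈ B × x ∈ C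
    helly₃ rA rB rC cA cB cC (a , a∈B , a∈C) (b , b∈C , b∈A) (c , c∈A , c∈B)
      with em {a ≈ b} | em {b ≈ c} | em {c ≈ a}
    ... | yes a≈b | _       | _       = a , rA (≈-sym a≈b) b∈A , a∈B , a∈C
    ... | no _    | yes b≈c | _       = b , b∈A , rB (≈-sym b≈c) c∈B , b∈C
    ... | no _    | no _    | yes c≈a = c , c∈A , c∈B , rC (≈-sym c≈a) a∈C
    ... | no a≉b  | no b≉c  | no c≉a with median a b c a≉b b≉c c≉a
    ...   | x , (x∈ab , x∈bc , x∈ca) , _ =
      x , convex-interval rA cA b∈A c∈A x∈bc
        , convex-interval rB cB c∈B a∈B x∈ca
        , convex-interval rC cC a∈C b∈C x∈ab

    -- Induction on the number of sets: replace the family by the intersections of its first member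
    -- with each of the others. They are convex, and `helly₃` shows that they still meet pairwise.
    helly : ∀ n (A : Fin (ℕ.suc n) → Pred V ℓ) →
            (∀ i → A i Respects _≈_) → (∀ i → IsConvex G (A i)) →
            (∀ i j → ∃ (A i ∩ A j)) → ∃ λ x → ∀ i → x ∈ A i
    helly zero A resp convex meet with meet zero zero
    ... | x , x∈A , _ = x , λ { zero → x∈A }
    helly (ℕ.suc n) A resp convex meet
      with helly n (λ i → A zero ∩ A (Fin.suc i))
             (λ i x≈y (p , q) → resp zero x≈y p , resp (Fin.suc i) x≈y q)
             (λ i → IsConvex-∩ (convex zero) (convex (Fin.suc i)))
             (λ i j → let x , x∈₀ , x∈ᵢ , x∈ⱼ =
                            helly₃ (resp zero) (resp (Fin.suc i)) (resp (Fin.suc j))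
                              (convex zero) (convex (Fin.suc i)) (convex (Fin.suc j))
                              (meet (Fin.suc i) (Fin.suc j)) (meet (Fin.suc j) zero)
                              (meet zero (Fin.suc i))
                      in x , (x∈₀ , x∈ᵢ) , (x∈₀ , x∈ⱼ))
    ... | x , x∈A = x , λ { zero → proj₁ (x∈A zero) ; (Fin.suc i) → proj₂ (x∈A i) }

-- Cardinalities measured by finite injections.

module Cardinality (em : ExcludedMiddle ℓ) (S : Setoid ℓ ℓ) where
  open Setoid S using (_≈_) renaming (Carrier to V; sym to ≈-sym; trans to ≈-trans)

  record Injection (A : Pred V ℓ) (n : ℕ) : Set ℓ where
    field
      to        : Fin n → ∃ A
      injective : ∀ {i j} → proj₁ (to i) ≈ proj₁ (to j) → i ≡ j

  injection-≤-card : ∀ {A n} → Injection A n → [ n ] ≤⁺ card S em A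
  injection-≤-card {A} {n} f with em {∃ (HasSize S A)}
  ... | no _        = [ n ] ≤⊤⁺
  ... | yes (m , b) = [ injective⇒≤ {f = λ i → proj₁ (from (f.to i))} inj ]
    where
    module f = Injection f
    module b = Bijection b
    from : (y : ∃ A) → ∃ λ i → proj₁ (b.to i) ≈ proj₁ y
    from y = let i , eq = b.surjective y in i , eq refl
    inj : ∀ {i j} → proj₁ (from (f.to i)) ≡ proj₁ (from (f.to j)) → i ≡ j
    inj {i} {j} eq = f.injective
      (≈-trans (≈-sym (proj₂ (from (f.to i))))
        (subst (λ k → proj₁ (b.to k) ≈ proj₁ (f.to j)) (sym eq) (proj₂ (from (f.to j)))))

  -- Built one point at a time. If no fresh point were available, the injection so far would be onto
  -- and `A` would have size `n`.
  infinite-injection : ∀ {A} → ¬ ∃ (HasSize S A) → ∀ n → Injection A n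
  infinite-injection inf zero = record { to = λ () ; injective = λ { {()} } }
  infinite-injection {A} inf (ℕ.suc n)
    with infinite-injection inf n
  ... | f with em {∃ λ (y : ∃ A) → ∀ i → ¬ proj₁ (Injection.to f i) ≈ proj₁ y}
  ...   | yes (y , fresh) = record { to = to′ ; injective = inj _ _ }
    where
    module f = Injection f
    to′ : Fin (ℕ.suc n) → ∃ A
    to′ zero        = y
    to′ (Fin.suc i) = f.to i
    inj : ∀ i j → proj₁ (to′ i) ≈ proj₁ (to′ j) → i ≡ j
    inj zero        zero        eq = refl
    inj zero        (Fin.suc j) eq = contradiction (≈-sym eq) (fresh j)
    inj (Fin.suc i) zero        eq = contradiction eq (fresh i)
    inj (Fin.suc i) (Fin.suc j) eq = cong Fin.suc (f.injective eq)
  ...   | no full = contradiction (n , bijection) inf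
    where
    module f = Injection f
    preimage : ∀ y → ∃ λ i → proj₁ (f.to i) ≈ proj₁ y
    preimage y with em {∃ λ i → proj₁ (f.to i) ≈ proj₁ y}
    ... | yes p = p
    ... | no ¬p = contradiction (y , λ i eq → ¬p (i , eq)) full
    bijection : HasSize S A n
    bijection = record
      { to        = f.to
      ; cong      = λ { refl → Setoid.refl S }
      ; bijective = f.injective , λ y → proj₁ (preimage y) , λ { refl → proj₂ (preimage y) }
      }

  -- This reduces bounds on possibly infinite sets to their finite subsets.
  card-≤ : ∀ {A b} → (∀ {n} → Injection A n → [ n ] ≤⁺ b) → card S em A ≤⁺ b
  card-≤ {A} {b} bound with em {∃ (HasSize S A)}
  ... | yes (n , f) =
    bound record { to = Bijection.to f ; injective = Bijection.injective f }
  card-≤ {A} {⊤⁺}    bound | no _   = ⊤⁺ ≤⊤⁺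
  -- An infinite set cannot have a finite bound `k`: it contains `suc k` distinct points.
  card-≤ {A} {[ k ]} bound | no inf with bound (infinite-injection inf (ℕ.suc k))
  ...   | [ 1+k≤k ] = contradiction 1+k≤k 1+n≰n

-- The graph of finite cliques.

module SimplexGraph (em : ExcludedMiddle ℓ) (G : Graph ℓ) where
  open Graph G using (V; Adj; Adj-sym; Adj-irrefl) renaming (_≈_ to _≈ᵥ_; vertices to S)
  open Setoid S using () renaming (refl to ≈-refl; sym to ≈-sym; trans to ≈-trans)
  open Membership S using () renaming (_∈_ to _∈ᴸ_)
  open Membershipₚ using (∈-resp-≈; ∈-++⁺ˡ; ∈-++⁺ʳ; ∈-filter⁺; ∈-filter⁻)

  -- A list is used as a finite set: order and repetitions are forgotten by `_≋_`, and adjacency is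
  -- asked only of inequivalent members, so repetitions do no harm.
  record FiniteClique : Set ℓ where
    constructor clique
    field
      members  : List V
      adjacent : ∀ {x y} → x ∈ᴸ members → y ∈ᴸ members → ¬ x ≈ᵥ y → Adj x y
  open FiniteClique

  infix 4 _∋_
  _∋_ : FiniteClique → V → Set ℓ
  A ∋ v = v ∈ᴸ members A

  ∋-resp : ∀ A {v w} → v ≈ᵥ w → A ∋ v → A ∋ w
  ∋-resp A = ∈-resp-≈ S

  dec : (P : V → Set ℓ) → ∀ v → Dec (P v)
  dec P v = em

  sift : (P : V → Set ℓ) → List V → List V
  sift P = filter (dec P)

  record _≋_ (A B : FiniteClique) : Set ℓ where
    constructor _,_
    field
      ⊆ : ∀ {v} → A ∋ v → B ∋ v
      ⊇ : ∀ {v} → B ∋ v → A ∋ v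
  open _≋_

  simplices : Setoid ℓ ℓ
  simplices = record
    { Carrier = FiniteClique
    ; _≈_ = _≋_
    ; isEquivalence = record
      { refl  = id , id
      ; sym   = λ e → ⊇ e , ⊆ e
      ; trans = λ e f → (⊆ f ∘ ⊆ e) , (⊇ e ∘ ⊇ f)
      }
    }

  -- Membership in the symmetric difference.
  Differ : FiniteClique → FiniteClique → V → Set ℓ
  Differ A B v = (A ∋ v × ¬ B ∋ v) ⊎ (¬ A ∋ v × B ∋ v)

  Differ-sym : ∀ {A B v} → Differ A B v → Differ B A v
  Differ-sym (inj₁ (a , b)) = inj₂ (b , a)
  Differ-sym (inj₂ (a , b)) = inj₁ (b , a)

  Differ-resp-≈ : ∀ {A B v w} → v ≈ᵥ w → Differ A B v → Differ A B w
  Differ-resp-≈ {A} {B} e (inj₁ (a , b)) = inj₁ (∋-resp A e a , b ∘ ∋-resp B (≈-sym e))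
  Differ-resp-≈ {A} {B} e (inj₂ (a , b)) = inj₂ (a ∘ ∋-resp A (≈-sym e) , ∋-resp B e b)

  Differ-respʳ : ∀ {A B C v} → B ≋ C → Differ A B v → Differ A C v
  Differ-respʳ e (inj₁ (a , b)) = inj₁ (a , b ∘ ⊇ e)
  Differ-respʳ e (inj₂ (a , b)) = inj₂ (a , ⊆ e b)

  Differ-trans : ∀ {A B v} X → Differ A B v → Differ A X v ⊎ Differ X B v
  Differ-trans {v = v} X d with em {X ∋ v} | d
  ... | yes x | inj₁ (a , b) = inj₂ (inj₁ (x , b))
  ... | yes x | inj₂ (a , b) = inj₁ (inj₂ (a , x))
  ... | no x  | inj₁ (a , b) = inj₁ (inj₁ (a , x))
  ... | no x  | inj₂ (a , b) = inj₂ (inj₂ (x , b))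

  -- Membership has only two values, so changing it twice restores it.
  Differ-cancel : ∀ {A X B v} → Differ A X v → Differ X B v → ¬ Differ A B v
  Differ-cancel (inj₁ (a , x)) (inj₁ (x′ , b)) _              = x x′
  Differ-cancel (inj₁ (a , x)) (inj₂ (x′ , b)) (inj₁ (_ , b′)) = b′ b
  Differ-cancel (inj₁ (a , x)) (inj₂ (x′ , b)) (inj₂ (a′ , _)) = a′ a
  Differ-cancel (inj₂ (a , x)) (inj₁ (x′ , b)) (inj₁ (a′ , _)) = a a′
  Differ-cancel (inj₂ (a , x)) (inj₁ (x′ , b)) (inj₂ (_ , b′)) = b b′
  Differ-cancel (inj₂ (a , x)) (inj₂ (x′ , b)) _              = x′ x

  agree : ∀ {A B} → (∀ {v} → ¬ Differ A B v) → A ≋ B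
  agree {A} {B} same = to , from
    where
    to : ∀ {v} → A ∋ v → B ∋ v
    to {v} a with em {B ∋ v}
    ... | yes b = b
    ... | no b  = contradiction (inj₁ (a , b)) same
    from : ∀ {v} → B ∋ v → A ∋ v
    from {v} b with em {A ∋ v}
    ... | yes a = a
    ... | no a  = contradiction (inj₂ (a , b)) same

  Toggle : V → FiniteClique → FiniteClique → Set ℓ
  Toggle x A B = Differ A B x × (∀ {v} → Differ A B v → v ≈ᵥ x)

  toggle-sym : ∀ {x A B} → Toggle x A B → Toggle x B A
  toggle-sym {A = A} {B} (d , f) = Differ-sym {A} {B} d , f ∘ Differ-sym {B} {A}

  toggle-respʳ : ∀ {x A B C} → B ≋ C → Toggle x A B → Toggle x A C
  toggle-respʳ {A = A} {B} {C} e (d , f) =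
    Differ-respʳ {A} {B} {C} e d ,
    f ∘ Differ-respʳ {A} {C} {B} (Setoid.sym simplices e)

  simplexGraph : Graph ℓ
  simplexGraph = record
    { vertices   = simplices
    ; Adj        = λ A B → ∃ λ x → Toggle x A B
    ; Adj-resp-≈ = (λ {A} e (x , t) → x , toggle-respʳ {A = A} e t)
                 , (λ {A} {B} {C} e (x , t) →
                      x , toggle-sym {A = A} {C} (toggle-respʳ {A = A} e (toggle-sym {A = B} {A} t)))
    ; Adj-sym    = λ {A} {B} (x , t) → x , toggle-sym {A = A} {B} t
    ; Adj-irrefl = λ { e (x , inj₁ (a , b) , _) → b (⊆ e a)
                     ; e (x , inj₂ (a , b) , _) → a (⊇ e b) }
    }

  open Walks em simplexGraph

  ≉-resp : ∀ {x} → (λ v → ¬ v ≈ᵥ x) Respects _≈ᵥ_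
  ≉-resp e n e′ = n (≈-trans e e′)

  -- Distances as sizes of covers of the symmetric difference.

  _∖_ : FiniteClique → V → FiniteClique
  A ∖ x = clique (sift (λ v → ¬ v ≈ᵥ x) (members A))
                 (λ p q → adjacent A (∖-⊆ p) (∖-⊆ q))
    where
    ∖-⊆ : ∀ {v} → v ∈ᴸ sift (λ v → ¬ v ≈ᵥ x) (members A) → A ∋ v
    ∖-⊆ = proj₁ ∘ ∈-filter⁻ S (dec _) ≉-resp

  ∋-∖⁻ : ∀ A {x v} → A ∖ x ∋ v → A ∋ v × ¬ v ≈ᵥ x
  ∋-∖⁻ A = ∈-filter⁻ S (dec _) ≉-resp

  ∋-∖⁺ : ∀ A {x v} → A ∋ v → ¬ v ≈ᵥ x → A ∖ x ∋ v
  ∋-∖⁺ A = ∈-filter⁺ S (dec _) ≉-resp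

  toggle-∖ : ∀ A {x} → A ∋ x → Toggle x A (A ∖ x)
  toggle-∖ A {x} a = inj₁ (a , λ a∖x → proj₂ (∋-∖⁻ A a∖x) ≈-refl) , only
    where
    only : ∀ {v} → Differ A (A ∖ x) v → v ≈ᵥ x
    only (inj₂ (¬a , b)) = contradiction (proj₁ (∋-∖⁻ A b)) ¬a
    only {v} (inj₁ (a , b)) with em {v ≈ᵥ x}
    ... | yes e = e
    ... | no ne = contradiction (∋-∖⁺ A a ne) b

  Covers : List V → FiniteClique → FiniteClique → Set ℓ
  Covers xs A B = ∀ {v} → Differ A B v → v ∈ᴸ xs

  walk-cover : ∀ {A B n} → Walk A B n → ∃ λ xs → length xs ≡ n × Covers xs A B
  walk-cover (nil e) = [] , refl , λ { (inj₁ (a , b)) → contradiction (⊆ e a) b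
                                     ; (inj₂ (a , b)) → contradiction (⊇ e b) a }
  walk-cover {A} {B} (cons {w = X} (x , _ , only) p) with walk-cover p
  ... | xs , refl , cov =
    x ∷ xs , refl , λ d → [ here ∘ only , there ∘ cov ]′ (Differ-trans {A} {B} X d)

  -- Each x of the cover on which A and B differ is deleted from the end containing it,
  -- so the walk grows at both ends and stays within finite cliques.
  cover-walk : ∀ xs {A B} → Covers xs A B → ∃ λ n → n ≤ length xs × Walk A B n
  cover-walk [] cov = 0 , z≤n , nil (agree λ d → contradiction (cov d) λ ())
  cover-walk (x ∷ xs) {A} {B} cov with em {Differ A B x}
  ... | no same =
    let n , n≤ , p = cover-walk xs {A} {B}
                       (λ d → Any.tail (λ e → same (Differ-resp-≈ {A} {B} e d)) (cov d))
    in n , m≤n⇒m≤1+n n≤ , p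
  ... | yes (inj₁ (a , b)) =
    let n , n≤ , p = cover-walk xs {A ∖ x} {B} cov′
    in ℕ.suc n , s≤s n≤ , cons (x , toggle-∖ A a) p
    where
    cov′ : Covers xs (A ∖ x) B
    cov′ (inj₁ (a′ , b′)) = let a″ , ne = ∋-∖⁻ A a′ in Any.tail ne (cov (inj₁ (a″ , b′)))
    cov′ {v} (inj₂ (a′ , b′)) = Any.tail ne (cov (inj₂ ((λ a″ → a′ (∋-∖⁺ A a″ ne)) , b′)))
      where
      ne : ¬ v ≈ᵥ x
      ne e = b (∋-resp B e b′)
  ... | yes (inj₂ (a , b)) =
    let n , n≤ , p = cover-walk xs {A} {B ∖ x} cov′
    in ℕ.suc n , s≤s n≤ , snoc p (x , toggle-sym {A = B} {B ∖ x} (toggle-∖ B b))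
    where
    cov′ : Covers xs A (B ∖ x)
    cov′ (inj₂ (a′ , b′)) = let b″ , ne = ∋-∖⁻ B b′ in Any.tail ne (cov (inj₂ (a′ , b″)))
    cov′ {v} (inj₁ (a′ , b′)) = Any.tail ne (cov (inj₁ (a′ , λ b″ → b′ (∋-∖⁺ B b″ ne))))
      where
      ne : ¬ v ≈ᵥ x
      ne e = a (∋-resp A e a′)

  distance : ∀ A B → ∃ (IsDistance simplexGraph A B)
  distance A B =
    let n , _ , p = cover-walk (members A ++ members B) {A} {B} cov
        m , _ , d = walk-distance p
    in m , d
    where
    cov : Covers (members A ++ members B) A B
    cov (inj₁ (a , _)) = ∈-++⁺ˡ S a
    cov (inj₂ (_ , b)) = ∈-++⁺ʳ S (members A) b

  distance-≤-cover : ∀ {A B n} xs → Covers xs A B → Shortest A B n → n ≤ length xs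
  distance-≤-cover {A} {B} xs cov s =
    let m , m≤ , p = cover-walk xs cov in ≤-trans (s m p) m≤

  -- If `v` changed on both halves, `A` and `B` would agree on it. Both halves yield covers, and
  -- their union without `v` would still cover the difference of `A` and `B` while being strictly
  -- shorter than `m + n`.
  shortest-no-backtrack : ∀ {A X B m n v} → Walk A X m → Walk X B n → Shortest A B (m + n) →
                          Differ A X v → ¬ Differ X B v
  shortest-no-backtrack {A} {X} {B} {v = v} p q s d₁ d₂
    with walk-cover p | walk-cover q
  ... | xs , refl , cov₁ | ys , refl , cov₂ =
    contradiction (distance-≤-cover zs cov s) (<⇒≱ zs<)
    where
    zs = sift (λ w → ¬ w ≈ᵥ v) (xs ++ ys)
    zs< : length zs < length xs + length ys
    zs< = subst (length zs <_) (length-++ xs) (filter-notAll (dec _) (xs ++ ys)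
            (Any.map (λ e ne → ne (≈-sym e)) (∈-++⁺ˡ S (cov₁ d₁))))
    cov : Covers zs A B
    cov {w} d = ∈-filter⁺ S (dec _) ≉-resp
      ([ ∈-++⁺ˡ S ∘ cov₁ , ∈-++⁺ʳ S xs ∘ cov₂ ]′ (Differ-trans {A} {B} X d))
      (λ e → Differ-cancel {A} {X} {B} d₁ d₂ (Differ-resp-≈ {A} {B} e d))

  -- Intervals of the simplex graph.

  filter-split : ∀ (P : V → Set ℓ) xs →
                 length (sift P xs) + length (sift (¬_ ∘ P) xs) ≤ length xs
  filter-split P []       = z≤n
  -- The two filters decide `P x` and `¬ P x` by separate uses of excluded middle, so the two
  -- inconsistent outcomes have to be refuted.
  filter-split P (x ∷ xs) with em {P x} | em {¬ P x}
  ... | yes p | yes ¬p = contradiction p ¬p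
  ... | yes p | no  _  = s≤s (filter-split P xs)
  ... | no ¬p | yes _  = subst (_≤ ℕ.suc (length xs)) (sym (+-suc _ _)) (s≤s (filter-split P xs))
  ... | no ¬p | no ¬¬p = contradiction ¬p ¬¬p

  -- Disjointness of the symmetric differences of `A` with `X` and of `X` with `B`; classically this
  -- is A ∩ B ⊆ X ⊆ A ∪ B.
  Between : FiniteClique → FiniteClique → FiniteClique → Set ℓ
  Between A B X = ∀ {v} → Differ A X v → ¬ Differ X B v

  interval⁻ : ∀ {A B X} → I simplexGraph A B X → Between A B X
  interval⁻ {A} {B} {X} (m , n , (p , _) , (q , _) , d) =
    shortest-no-backtrack {A} {X} {B} (path-walk p) (path-walk q) (distance-shortest d)

  -- Any walk from `A` to `B` yields a cover of their difference. Its elements on which `A` and `X`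
  -- differ cover that difference, the remaining ones cover that of `X` and `B`, so the walk is at
  -- least as long as the two distances together.
  interval⁺ : ∀ {A B X} → Between A B X → I simplexGraph A B X
  interval⁺ {A} {B} {X} btw with distance A X | distance X B
  ... | m , d₁ | n , d₂ =
    m , n , d₁ , d₂ ,
    shortest-distance (concat (path-walk (proj₁ d₁)) (path-walk (proj₁ d₂))) minimal
    where
    minimal : Shortest A B (m + n)
    minimal k p with walk-cover p
    ... | xs , refl , cov = ≤-trans
      (+-mono-≤ (distance-≤-cover (sift (Differ A X) xs) cov₁ (distance-shortest d₁))
                (distance-≤-cover (sift (¬_ ∘ Differ A X) xs) cov₂ (distance-shortest d₂)))
      (filter-split (Differ A X) xs)
      where
      -- Since the two differences are disjoint, a change made on one half is never undone on the
      -- other.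
      not-cancelled : ∀ {v} → Differ A X v ⊎ Differ X B v → Differ A B v
      not-cancelled {v} (inj₁ d) with Differ-trans {A} {X} B d
      ... | inj₁ d′ = d′
      ... | inj₂ d′ = contradiction (Differ-sym {B} {X} d′) (btw d)
      not-cancelled {v} (inj₂ d) with Differ-trans {X} {B} A d
      ... | inj₁ d′ = contradiction d (btw (Differ-sym {X} {A} d′))
      ... | inj₂ d′ = d′
      cov₁ : Covers (sift (Differ A X) xs) A X
      cov₁ d = ∈-filter⁺ S (dec _) (Differ-resp-≈ {A} {X}) (cov (not-cancelled (inj₁ d))) d
      cov₂ : Covers (sift (¬_ ∘ Differ A X) xs) X B
      cov₂ d = ∈-filter⁺ S (dec _) (λ e n d′ → n (Differ-resp-≈ {A} {X} (≈-sym e) d′))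
        (cov (not-cancelled (inj₂ d))) (λ d′ → btw d′ d)

  between-∩ : ∀ {A B X v} → Between A B X → A ∋ v → B ∋ v → X ∋ v
  between-∩ {X = X} {v} btw a b with em {X ∋ v}
  ... | yes x = x
  ... | no x  = contradiction (inj₂ (x , b)) (btw (inj₁ (a , x)))

  between-∪ : ∀ {A B X v} → Between A B X → X ∋ v → A ∋ v ⊎ B ∋ v
  between-∪ {A} {B} {X} {v} btw x with em {A ∋ v} | em {B ∋ v}
  ... | yes a | _     = inj₁ a
  ... | no _  | yes b = inj₂ b
  ... | no a  | no b  = contradiction (inj₁ (x , b)) (btw (inj₂ (a , x)))

  ∩-∪-between : ∀ {A B X} → (∀ {v} → A ∋ v → B ∋ v → X ∋ v) →
                (∀ {v} → X ∋ v → A ∋ v ⊎ B ∋ v) → Between A B X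
  ∩-∪-between ∩⊆ ⊆∪ (inj₁ (a , x)) (inj₁ (x′ , _)) = x x′
  ∩-∪-between ∩⊆ ⊆∪ (inj₁ (a , x)) (inj₂ (_ , b))  = x (∩⊆ a b)
  ∩-∪-between ∩⊆ ⊆∪ (inj₂ (a , x)) (inj₁ (_ , b))  = [ a , b ]′ (⊆∪ x)
  ∩-∪-between ∩⊆ ⊆∪ (inj₂ (a , x)) (inj₂ (x′ , _)) = x′ x

  -- Medians as majorities.

  module Majority (A B C : FiniteClique) where

    Maj : V → Set ℓ
    Maj v = (A ∋ v × B ∋ v) ⊎ (B ∋ v × C ∋ v) ⊎ (C ∋ v × A ∋ v)

    Maj-resp : ∀ {v w} → v ≈ᵥ w → Maj v → Maj w
    Maj-resp e (inj₁ (a , b))        = inj₁ (∋-resp A e a , ∋-resp B e b)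
    Maj-resp e (inj₂ (inj₁ (b , c))) = inj₂ (inj₁ (∋-resp B e b , ∋-resp C e c))
    Maj-resp e (inj₂ (inj₂ (c , a))) = inj₂ (inj₂ (∋-resp C e c , ∋-resp A e a))

    -- Two elements, each in two of the three cliques, lie together in one of them.
    Maj-adjacent : ∀ {x y} → Maj x → Maj y → ¬ x ≈ᵥ y → Adj x y
    Maj-adjacent (inj₁ (a , b))        (inj₁ (a′ , b′))        = adjacent A a a′
    Maj-adjacent (inj₁ (a , b))        (inj₂ (inj₁ (b′ , c′))) = adjacent B b b′
    Maj-adjacent (inj₁ (a , b))        (inj₂ (inj₂ (c′ , a′))) = adjacent A a a′
    Maj-adjacent (inj₂ (inj₁ (b , c))) (inj₁ (a′ , b′))        = adjacent B b b′
    Maj-adjacent (inj₂ (inj₁ (b , c))) (inj₂ (inj₁ (b′ , c′))) = adjacent B b b′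
    Maj-adjacent (inj₂ (inj₁ (b , c))) (inj₂ (inj₂ (c′ , a′))) = adjacent C c c′
    Maj-adjacent (inj₂ (inj₂ (c , a))) (inj₁ (a′ , b′))        = adjacent A a a′
    Maj-adjacent (inj₂ (inj₂ (c , a))) (inj₂ (inj₁ (b′ , c′))) = adjacent C c c′
    Maj-adjacent (inj₂ (inj₂ (c , a))) (inj₂ (inj₂ (c′ , a′))) = adjacent C c c′

    -- Whatever lies in two of the three cliques lies in `A` or `B`, so these two lists supply all
    -- candidates.
    elements : List V
    elements = sift Maj (members A ++ members B)

    elements⁻ : ∀ {v} → v ∈ᴸ elements → Maj v
    elements⁻ p = proj₂ (∈-filter⁻ S (dec Maj) Maj-resp {xs = members A ++ members B} p)

    majority : FiniteClique
    majority = clique elements (λ p q → Maj-adjacent (elements⁻ p) (elements⁻ q))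

    majority⁺ : ∀ {v} → Maj v → majority ∋ v
    majority⁺ {v} m = ∈-filter⁺ S (dec Maj) Maj-resp (candidate m) m
      where
      candidate : Maj v → v ∈ᴸ members A ++ members B
      candidate (inj₁ (a , _))        = ∈-++⁺ˡ S a
      candidate (inj₂ (inj₁ (b , _))) = ∈-++⁺ʳ S (members A) b
      candidate (inj₂ (inj₂ (_ , a))) = ∈-++⁺ˡ S a

    between-AB : Between A B majority
    between-AB = ∩-∪-between {A} {B} {majority} (λ a b → majority⁺ (inj₁ (a , b)))
      (λ m → [ inj₁ ∘ proj₁ , [ inj₂ ∘ proj₁ , inj₁ ∘ proj₂ ]′ ]′ (elements⁻ m))

    between-BC : Between B C majority
    between-BC = ∩-∪-between {B} {C} {majority} (λ b c → majority⁺ (inj₂ (inj₁ (b , c))))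
      (λ m → [ inj₁ ∘ proj₂ , [ inj₁ ∘ proj₁ , inj₂ ∘ proj₁ ]′ ]′ (elements⁻ m))

    between-CA : Between C A majority
    between-CA = ∩-∪-between {C} {A} {majority} (λ c a → majority⁺ (inj₂ (inj₂ (c , a))))
      (λ m → [ inj₂ ∘ proj₁ , [ inj₁ ∘ proj₂ , inj₁ ∘ proj₁ ]′ ]′ (elements⁻ m))

    -- Betweenness puts all pairwise intersections into `X`. Conversely, a member of `X` lies in all
    -- three pairwise unions, which forces it into at least two of the cliques.
    majority-unique : ∀ {X} → Between A B X → Between B C X → Between C A X → majority ≋ X
    majority-unique {X} ab bc ca = (to ∘ elements⁻) , (majority⁺ ∘ from)
      where
      to : ∀ {v} → Maj v → X ∋ v
      to (inj₁ (a , b))        = between-∩ {A} {B} {X} ab a b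
      to (inj₂ (inj₁ (b , c))) = between-∩ {B} {C} {X} bc b c
      to (inj₂ (inj₂ (c , a))) = between-∩ {C} {A} {X} ca c a
      from : ∀ {v} → X ∋ v → Maj v
      from x with between-∪ {A} {B} {X} ab x | between-∪ {B} {C} {X} bc x | between-∪ {C} {A} {X} ca x
      ... | inj₁ a | inj₁ b | _      = inj₁ (a , b)
      ... | inj₁ a | inj₂ c | _      = inj₂ (inj₂ (c , a))
      ... | inj₂ b | _      | inj₁ c = inj₂ (inj₁ (b , c))
      ... | inj₂ b | _      | inj₂ a = inj₁ (a , b)

  -- The median decomposition into finite cliques.

  simplexGraph-isMedian : IsMedianGraph simplexGraph
  simplexGraph-isMedian = record
    { connected = λ A B → map₂ proj₁ (distance A B)
    ; median    = λ A B C _ _ _ → let open Majority A B C in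
        majority
      , (interval⁺ between-AB , interval⁺ between-BC , interval⁺ between-CA)
      , λ {X} (ab , bc , ca) →
          majority-unique {X} (interval⁻ {A} {B} {X} ab) (interval⁻ {B} {C} {X} bc)
            (interval⁻ {C} {A} {X} ca)
    }

  -- A vertex of a geodesic cuts it into two walks of the same total length, so it lies between the
  -- ends and contains their intersection.
  ∋-convex : ∀ v → IsConvex simplexGraph (_∋ v)
  ∋-convex v {A} {B} a b n d p i = between-∩ {A} {B} {X} btw a b
    where
    X = Path.vertex p i
    btw : Between A B X
    btw = shortest-no-backtrack {A} {X} {B} (path-prefix p i) (path-suffix p i)
      (subst (Shortest A B) (sym (m+[n∸m]≡n (toℕ≤pred[n] i))) (distance-shortest d))

  edge : ∀ {x y} → Adj x y → FiniteClique
  edge {x} {y} xy = clique (x ∷ y ∷ []) adj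
    where
    adj-resp : ∀ {u v} → u ≈ᵥ x → v ≈ᵥ y → Adj u v
    adj-resp u≈x v≈y =
      proj₁ (Graph.Adj-resp-≈ G) (≈-sym v≈y) (proj₂ (Graph.Adj-resp-≈ G) (≈-sym u≈x) xy)
    adj : ∀ {u v} → u ∈ᴸ x ∷ y ∷ [] → v ∈ᴸ x ∷ y ∷ [] → ¬ u ≈ᵥ v → Adj u v
    adj (here u≈x)         (here v≈x)         ne = contradiction (≈-trans u≈x (≈-sym v≈x)) ne
    adj (here u≈x)         (there (here v≈y)) ne = adj-resp u≈x v≈y
    adj (there (here u≈y)) (here v≈x)         ne = Adj-sym (adj-resp v≈x u≈y)
    adj (there (here u≈y)) (there (here v≈y)) ne = contradiction (≈-trans u≈y (≈-sym v≈y)) ne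

  singleton : V → FiniteClique
  singleton v = clique (v ∷ []) λ where
    (here x≈v) (here y≈v) ne → contradiction (≈-trans x≈v (≈-sym y≈v)) ne

  decomposition : MedianDecomposition G
  decomposition = record
    { M        = simplexGraph
    ; isMedian = simplexGraph-isMedian
    ; β        = _∋_
    ; β-resp-M = λ e → ⊆ e
    ; β-resp-G = λ {A} → ∋-resp A
    ; M1       = λ v → singleton v , here ≈-refl
    ; M2       = λ xy → edge xy , here ≈-refl , there (here ≈-refl)
    ; M3       = ∋-convex
    }

  toClique : FiniteClique → Clique G
  toClique A = record { members = A ∋_ ; resp-≈ = ∋-resp A ; adjacent = adjacent A }

-- The two inequalities.

module _ (em : ExcludedMiddle (suc ℓ)) (G : Graph ℓ) where
  private
    em₀ : ExcludedMiddle ℓ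
    em₀ = lowerEM em
  open Graph G
  open Cardinality em₀ vertices

  card-≤-ω : ∀ K → card vertices em₀ (Clique.members K) ≤⁺ ω em G
  card-≤-ω = proj₁ (proj₂ (supremum em _))

  -- The width of `decomposition` is a supremum over finite cliques of `G`, and `ω` bounds each of
  -- them.
  mw≤ω : mw em G ≤⁺ ω em G
  mw≤ω = ≤⁺-trans ≤-trans (proj₁ (proj₂ (infimum em (width em G))) decomposition)
    (proj₂ (proj₂ (supremum em₀ _)) (ω em G) (λ A → card-≤-ω (toClique A)))
    where open SimplexGraph em₀ G

  finite-clique-≤-width : (D : MedianDecomposition G) (K : Clique G) → ∀ {n} →
                          Injection (Clique.members K) n → [ n ] ≤⁺ width em G D
  -- `helly` speaks of nonempty families, so the empty clique is treated separately.
  finite-clique-≤-width D K {zero} f = zero-≤ (width em G D)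
    where
    zero-≤ : ∀ b → [ 0 ] ≤⁺ b
    zero-≤ [ n ] = [ z≤n ]
    zero-≤ ⊤⁺    = [ 0 ] ≤⊤⁺
  -- The sets of bags containing a given clique member are convex by `M3`; a point common to all of
  -- them is a bag containing the whole image of `f`.
  finite-clique-≤-width D K {ℕ.suc n} f =
    let u , u∈ = helly isMedian n (λ i x → β x (proj₁ (f.to i))) (λ i → β-resp-M)
                   (λ i → M3 (proj₁ (f.to i))) meet
    in ≤⁺-trans ≤-trans
         (injection-≤-card record { to = λ i → proj₁ (f.to i) , u∈ i ; injective = f.injective })
         (proj₁ (proj₂ (supremum em₀ _)) u)
    where
    open MedianDecomposition D
    open Walks em₀ M
    module f = Injection f
    meet : ∀ i j → ∃ λ x → β x (proj₁ (f.to i)) × β x (proj₁ (f.to j))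
    -- Inequivalent members are adjacent and share a bag by `M2`; for equivalent ones any bag
    -- provided by `M1` will do.
    meet i j with em₀ {proj₁ (f.to i) ≈ proj₁ (f.to j)}
    ... | no ne = M2 (Clique.adjacent K (proj₂ (f.to i)) (proj₂ (f.to j)) ne)
    ... | yes e = let x , x∈ = M1 (proj₁ (f.to i)) in x , x∈ , β-resp-G e x∈

  -- A clique may be infinite, while Helly handles finite families only; `card-≤` bridges the gap.
  ω≤mw : ω em G ≤⁺ mw em G
  ω≤mw = proj₂ (proj₂ (supremum em _)) (mw em G) λ K →
    proj₂ (proj₂ (infimum em (width em G))) _ λ D → card-≤ (finite-clique-≤-width D K)

theorem1p3 : ∀ {ℓ : Level} (em : ExcludedMiddle (suc ℓ)) (G : Graph ℓ) →
    mw em G ≡ ω em G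
theorem1p3 em G = ≤⁺-antisym-≡ ≤-antisym (mw≤ω em G) (ω≤mw em G)
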